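{- Let $\Phi$ be the set of formulas of $NOM$, preordered by $\phi\le\psi$ iff $\phi\vdash\psi$ is derivable in $NOM$, let $\mathcal L$ be the partially ordered quotient obtained by identifying $\phi$ and $\psi$ when $\phi\le\psi$ and $\psi\le\phi$, with quotient map $[\,\cdot\,]:\Phi\to\mathcal L$, and let $\neg[\phi]=[\neg\phi]$ (this is a well-defined order-reversing involution). Then $(\mathcal L,\le,\neg)$ is an orthomodular lattice, and for all formulas $\phi,\psi$: $[\phi\wedge\psi]=[\phi]\wedge[\psi]$, $[\phi\rightarrow\psi]=[\phi]\rightarrow[\psi]$ (Sasaki arrow), and $[\neg\phi]=\neg[\phi]$.
   Context: The propositional deductive system $NOM$: formulas are built from propositional letters using $\wedge$, $\rightarrow$, $\neg$. Sequents are $\phi_1,\ldots,\phi_n\vdash\psi$ ($n\ge0$) with antecedent a finite ordered sequence. With $\Gamma$ a finite possibly empty sequence of formulas and $\phi,\psi,\chi$ formulas, the rules of $NOM$ are: (assumption) $\Gamma,\phi\vdash\phi$; (cut) $\Gamma\vdash\phi$, $\Gamma,\phi\vdash\psi$ $\Rightarrow$ $\Gamma\vdash\psi$; (paste) $\Gamma\vdash\phi$, $\Gamma\vdash\psi$ $\Rightarrow$ $\Gamma,\phi\vdash\psi$; (compatible exchange) $\Gamma,\phi,\psi\vdash\phi$, $\Gamma,\phi,\psi\vdash\chi$, $\Gamma,\psi,\phi\vdash\psi$ $\Rightarrow$ $\Gamma,\psi,\phi\vdash\chi$; ($\wedge$-intro) $\Gamma\vdash\phi$, $\Gamma\vdash\psi$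 $\Rightarrow$ $\Gamma\vdash\phi\wedge\psi$; ($\wedge$-elim) $\Gamma\vdash\phi\wedge\psi$ $\Rightarrow$ $\Gamma\vdash\phi$ and $\Rightarrow$ $\Gamma\vdash\psi$; ($\rightarrow$-intro) $\Gamma,\phi\vdash\psi$ $\Rightarrow$ $\Gamma\vdash\phi\rightarrow\psi$; ($\rightarrow$-elim) $\Gamma\vdash\phi\rightarrow\psi$ $\Rightarrow$ $\Gamma,\phi\vdash\psi$; (excluded middle) $\Gamma,\phi\vdash\psi$, $\Gamma,\neg\phi\vdash\psi$ $\Rightarrow$ $\Gamma\vdash\psi$; (explosion) $\Gamma\vdash\neg\phi$ $\Rightarrow$ $\Gamma,\phi\vdash\psi$. An orthomodular lattice is a bounded lattice with an order-reversing involution $\neg$ satisfying $a\wedge\neg a=\bot$, $a\vee\neg a=\top$, and $a\le b\Rightarrow a\vee(\neg a\wedge b)=b$; in it $a\rightarrow b=\neg a\vee(a\wedge b)$. -}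

module Defs where

open import Level using (Level; _⊔_)
open import Algebra.Core using (Op₁; Op₂)
open import Algebra.Definitions using (Involutive)
open import Data.List.Base using (List; []; _∷_)
open import Relation.Binary.Core using (Rel)
open import Relation.Binary.Construct.Interior.Symmetric using (SymInterior)
open import Relation.Binary.Definitions using (Antitonic₁)
open import Relation.Binary.Lattice.Structures using (IsBoundedLattice)

infixr 7 _`∧_
infixr 6 _`→_
infix  8 `¬_
infixl 5 _⸴_
infix  4 _⊢_

data Formula {a} (Letter : Set a) : Set a where
  letter : Letter → Formula Letter
  _`∧_   : (φ ψ : Formula Letter) → Formula Letter
  _`→_   : (φ ψ : Formula Letter) → Formula Letter
  `¬_    : (φ : Formula Letter) → Formula Letter

-- Antecedents are ordered sequences extended on the right, so the head of
-- the list is the last (rightmost) formula of the sequence.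
Antecedent : ∀ {a} → Set a → Set a
Antecedent Letter = List (Formula Letter)

pattern _⸴_ Γ φ = φ ∷ Γ

data _⊢_ {a} {Letter : Set a} : Antecedent Letter → Formula Letter → Set a where
  assumption : ∀ {Γ φ} → Γ ⸴ φ ⊢ φ
  cut        : ∀ {Γ φ ψ} → Γ ⊢ φ → Γ ⸴ φ ⊢ ψ → Γ ⊢ ψ
  paste      : ∀ {Γ φ ψ} → Γ ⊢ φ → Γ ⊢ ψ → Γ ⸴ φ ⊢ ψ
  compatible-exchange : ∀ {Γ φ ψ χ} →
    Γ ⸴ φ ⸴ ψ ⊢ φ → Γ ⸴ φ ⸴ ψ ⊢ χ → Γ ⸴ ψ ⸴ φ ⊢ ψ → Γ ⸴ ψ ⸴ φ ⊢ χ
  ∧-intro    : ∀ {Γ φ ψ} → Γ ⊢ φ → Γ ⊢ ψ → Γ ⊢ φ `∧ ψ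
  ∧-elimˡ    : ∀ {Γ φ ψ} → Γ ⊢ φ `∧ ψ → Γ ⊢ φ
  ∧-elimʳ    : ∀ {Γ φ ψ} → Γ ⊢ φ `∧ ψ → Γ ⊢ ψ
  →-intro    : ∀ {Γ φ ψ} → Γ ⸴ φ ⊢ ψ → Γ ⊢ φ `→ ψ
  →-elim     : ∀ {Γ φ ψ} → Γ ⊢ φ `→ ψ → Γ ⸴ φ ⊢ ψ
  excluded-middle : ∀ {Γ φ ψ} → Γ ⸴ φ ⊢ ψ → Γ ⸴ `¬ φ ⊢ ψ → Γ ⊢ ψ
  explosion  : ∀ {Γ φ ψ} → Γ ⊢ `¬ φ → Γ ⸴ φ ⊢ ψ

-- The bounded lattice operations are determined up to _≈_ by the order, so
-- they are components here rather than parameters; the structure is (≤ , ¬).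
record IsOrthomodularLattice {c ℓ₁ ℓ₂ : Level} {A : Set c}
                             (_≈_ : Rel A ℓ₁) (_≤_ : Rel A ℓ₂) (¬_ : Op₁ A)
                             : Set (c ⊔ ℓ₁ ⊔ ℓ₂) where
  infixr 7 _∧_
  infixr 6 _∨_
  infixr 5 _⇒_
  field
    _∨_ _∧_          : Op₂ A
    ⊤ ⊥              : A
    isBoundedLattice : IsBoundedLattice _≈_ _≤_ _∨_ _∧_ ⊤ ⊥
    ¬-antitone       : Antitonic₁ _≤_ _≤_ ¬_
    ¬-involutive     : Involutive _≈_ ¬_
    ∧-complement     : ∀ x → (x ∧ (¬ x)) ≈ ⊥
    ∨-complement     : ∀ x → (x ∨ (¬ x)) ≈ ⊤
    orthomodular     : ∀ x y → x ≤ y → (x ∨ ((¬ x) ∧ y)) ≈ y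

  open IsBoundedLattice isBoundedLattice public

  -- The Sasaki arrow.
  _⇒_ : Op₂ A
  x ⇒ y = (¬ x) ∨ (x ∧ y)

-- The quotient is rendered as a setoid: its elements are represented by
-- formulas, its equality is _≈_ below, and the quotient map [_] is the
-- identity on representatives.
module Lindenbaum {a} (Letter : Set a) where

  infix 4 _≤_ _≈_

  𝓛 : Set a
  𝓛 = Formula Letter

  [_] : Formula Letter → 𝓛
  [ φ ] = φ

  _≤_ : Rel 𝓛 a
  φ ≤ ψ = [] ⸴ φ ⊢ ψ

  _≈_ : Rel 𝓛 a
  _≈_ = SymInterior _≤_

  neg : Op₁ 𝓛
  neg φ = [ `¬ φ ]

{-# OPTIONS --safe #-}

-- Every rule only looks at the right end of the antecedent, so formulas may be
-- added on the left; this makes ≤ transitive and lets a valid φ ⊢ ψ act on the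
-- last formula of any antecedent. A sequent whose truth requires commuting φ
-- past ψ is reduced to one of these by compatible exchange, always in a
-- situation where one of the two orders is already contradictory.
module Submission where

open import Defs
open import Data.List.Base using ([]; _++_)
open import Data.Product.Base using (Σ-syntax; _×_; _,_)
open import Relation.Binary.Construct.Interior.Symmetric using (isPartialOrder)
  renaming (_,_ to _⇄_)

module _ {a} {Letter : Set a} where

  private variable
    Γ : Antecedent Letter
    φ ψ χ : Formula Letter

  weaken-left : ∀ Δ → Γ ⊢ φ → Γ ++ Δ ⊢ φ
  weaken-left Δ assumption                    = assumption
  weaken-left Δ (cut d e)                     = cut (weaken-left Δ d) (weaken-left Δ e)
  weaken-left Δ (paste d e)                   = paste (weaken-left Δ d) (weaken-left Δ e)
  weaken-left Δ (compatible-exchange d e f)   =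
    compatible-exchange (weaken-left Δ d) (weaken-left Δ e) (weaken-left Δ f)
  weaken-left Δ (∧-intro d e)                 = ∧-intro (weaken-left Δ d) (weaken-left Δ e)
  weaken-left Δ (∧-elimˡ d)                   = ∧-elimˡ (weaken-left Δ d)
  weaken-left Δ (∧-elimʳ d)                   = ∧-elimʳ (weaken-left Δ d)
  weaken-left Δ (→-intro d)                   = →-intro (weaken-left Δ d)
  weaken-left Δ (→-elim d)                    = →-elim (weaken-left Δ d)
  weaken-left Δ (excluded-middle d e)         = excluded-middle (weaken-left Δ d) (weaken-left Δ e)
  weaken-left Δ (explosion d)                 = explosion (weaken-left Δ d)

  infixl 4 _⨾_

  _⨾_ : Γ ⊢ φ → [] ⸴ φ ⊢ ψ → Γ ⊢ ψ
  d ⨾ e = cut d (weaken-left _ e)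

  contradiction : Γ ⊢ φ → Γ ⊢ `¬ φ → Γ ⊢ ψ
  contradiction d e = cut d (explosion e)

  ¬¬-elim : Γ ⸴ `¬ `¬ φ ⊢ φ
  ¬¬-elim = excluded-middle assumption (explosion assumption)

  -- Excluded middle is applied to ¬ φ before φ is assumed: under ¬ ¬ φ,
  -- assuming φ loses nothing.
  ¬¬-intro : Γ ⸴ φ ⊢ `¬ `¬ φ
  ¬¬-intro = →-elim (excluded-middle (→-intro (explosion assumption))
                                     (→-intro (paste ¬¬-elim assumption)))

  explosion-¬ : Γ ⊢ φ → Γ ⸴ `¬ φ ⊢ ψ
  explosion-¬ d = explosion (d ⨾ ¬¬-intro)

  -- In the opposite order, `Γ ⸴ ψ ⸴ φ`, everything follows: an inconsistent `ψ` yields `¬ φ`, which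
  -- explodes once `φ` is added. So only the survival of `φ` past `ψ` has to be supplied.
  exchange-inconsistent : (∀ {χ} → Γ ⸴ ψ ⊢ χ) → Γ ⸴ φ ⸴ ψ ⊢ φ → Γ ⸴ φ ⸴ ψ ⊢ χ
  exchange-inconsistent d e = compatible-exchange (explosion d) (explosion d) e

  contraposition : [] ⸴ φ ⊢ ψ → [] ⸴ `¬ ψ ⊢ `¬ φ
  -- Under `φ` the derived `ψ` is cut in; exchanging it with `φ` brings it next to `¬ ψ`.
  contraposition {φ} {ψ} d = excluded-middle (cut φ⊢ψ ¬ψ,φ,ψ⊢) assumption
    where
    φ⊢ψ : [] ⸴ `¬ ψ ⸴ φ ⊢ ψ
    φ⊢ψ = weaken-left _ d

    ¬ψ,φ,ψ⊢ : [] ⸴ `¬ ψ ⸴ φ ⸴ ψ ⊢ χ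
    ¬ψ,φ,ψ⊢ = exchange-inconsistent (explosion assumption) (paste φ⊢ψ assumption)

  -- Split on `ψ` after `φ`. In the case `¬ ψ` the hypothesis recovers `φ`, so `¬ ψ` can be moved
  -- back next to the initial `ψ`, which it contradicts.
  ¬≤⇒preserved : [] ⸴ `¬ ψ ⊢ φ → [] ⸴ ψ ⸴ φ ⊢ ψ
  ¬≤⇒preserved d =
    excluded-middle assumption
      (exchange-inconsistent (explosion-¬ assumption) (weaken-left _ d))

  infixr 6 _∨_

  -- The language has no disjunction, so the join is the De Morgan dual of the meet.
  _∨_ : Formula Letter → Formula Letter → Formula Letter
  φ ∨ ψ = `¬ (`¬ φ `∧ `¬ ψ)

  ∨-introˡ : [] ⸴ φ ⊢ φ ∨ ψ
  ∨-introˡ = ¬¬-intro ⨾ contraposition (∧-elimˡ assumption)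

  ∨-introʳ : [] ⸴ ψ ⊢ φ ∨ ψ
  ∨-introʳ = ¬¬-intro ⨾ contraposition (∧-elimʳ assumption)

  ∨-elim : [] ⸴ φ ⊢ χ → [] ⸴ ψ ⊢ χ → [] ⸴ φ ∨ ψ ⊢ χ
  ∨-elim d e = contraposition (∧-intro (contraposition d) (contraposition e)) ⨾ ¬¬-elim

  orthomodular : [] ⸴ φ ⊢ ψ → [] ⸴ ψ ⊢ φ ∨ (`¬ φ `∧ ψ)
  orthomodular d =
    excluded-middle
      (assumption ⨾ ∨-introˡ)
      -- Contraposing `d` puts `¬ ψ` below `¬ φ`, so `ψ` survives the assumption of `¬ φ`.
      (∧-intro assumption (¬≤⇒preserved (contraposition d)) ⨾ ∨-introʳ)

  →⇒sasaki : [] ⸴ φ `→ ψ ⊢ `¬ φ ∨ (φ `∧ ψ)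
  →⇒sasaki =
    excluded-middle
      (∧-intro assumption (→-elim assumption) ⨾ ∨-introʳ)
      (assumption ⨾ ∨-introˡ)

  sasaki⇒→ : [] ⸴ `¬ φ ∨ (φ `∧ ψ) ⊢ φ `→ ψ
  sasaki⇒→ = ∨-elim (→-intro (explosion assumption))
                    -- The conjunction already proves `φ`, so assuming `φ` again by `paste` keeps
                    -- `ψ`.
                    (→-intro (paste (∧-elimˡ assumption) (∧-elimʳ assumption)))

isOrthomodularLattice : ∀ {a} (Letter : Set a) → Letter →
  let open Lindenbaum Letter in IsOrthomodularLattice _≈_ _≤_ neg
isOrthomodularLattice Letter p = record
  { _∨_ = _∨_
  ; _∧_ = _`∧_
  -- The language has no constants, so the given letter supplies a contradiction for `⊥`, and its
  -- negation serves as `⊤`.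
  ; ⊤   = `¬ (letter p `∧ `¬ letter p)
  ; ⊥   = letter p `∧ `¬ letter p
  ; isBoundedLattice = record
    { isLattice = record
      { isPartialOrder = isPartialOrder assumption _⨾_
      ; supremum       = λ _ _ → ∨-introˡ , ∨-introʳ , λ _ → ∨-elim
      ; infimum        = λ _ _ → ∧-elimˡ assumption , ∧-elimʳ assumption , λ _ → ∧-intro
      }
    ; maximum = λ _ → ¬¬-intro ⨾ contraposition falsum
    ; minimum = λ _ → falsum
    }
  ; ¬-antitone   = contraposition
  ; ¬-involutive = λ _ → ¬¬-elim ⇄ ¬¬-intro
  ; ∧-complement = λ _ → falsum ⇄ falsum
  -- Both sides unfold to negated contradictions.
  ; ∨-complement = λ _ → (¬¬-intro ⨾ contraposition falsum) ⇄ contraposition falsum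
  ; orthomodular = λ _ _ d → ∨-elim d (∧-elimʳ assumption) ⇄ orthomodular d
  }
  where
  falsum : ∀ {φ ψ : Formula Letter} → [] ⸴ φ `∧ `¬ φ ⊢ ψ
  falsum = contradiction (∧-elimˡ assumption) (∧-elimʳ assumption)

theorem3p8 : ∀ {a} (Letter : Set a) → Letter →
    let open Lindenbaum Letter in
    Σ[ oml ∈ IsOrthomodularLattice _≈_ _≤_ neg ]
    let open IsOrthomodularLattice oml in
    ∀ (φ ψ : Formula Letter) →
    ([ φ `∧ ψ ] ≈ [ φ ] ∧ [ ψ ])
    × ([ φ `→ ψ ] ≈ [ φ ] ⇒ [ ψ ])
    × ([ `¬ φ ] ≈ neg [ φ ])
theorem3p8 Letter p = isOrthomodularLattice Letter p , λ φ ψ →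
  (assumption ⇄ assumption) , (→⇒sasaki ⇄ sasaki⇒→) , (assumption ⇄ assumption)
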